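{- For all positive integers $k,n$, $Z_{\mathcal{C}}(n;k)\le 2n(k-1)$, where $\mathcal{C}$ is the class of chordal bipartite graphs.
   Context: A bipartite graph is chordal bipartite if every cycle of length at least six has a chord. For a class $\mathcal{C}$ of bipartite graphs, $Z_{\mathcal{C}}(n;k)$ is the maximum number of edges of a graph $G=(U\cup V,E)\in\mathcal{C}$ with $|U|=|V|=n$ that does not contain $K_{k,k}$ as a subgraph. -}

module Defs where

open import Data.Nat using (ℕ; zero; suc; _≤_)
open import Data.Fin using (Fin; zero; suc; fromℕ; inject₁; _≟_)
open import Data.Bool using (Bool; true; false)
open import Data.List using (List; length; filter; allFin; cartesianProduct)
open import Data.Product using (Σ; _×_; _,_; proj₁; proj₂; ∃)
open import Function.Definitions using (Injective)
open import Relation.Binary.PropositionalEquality using (_≡_)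
open import Relation.Nullary using (¬_; Dec)
open import Data.Bool using (T)
open import Relation.Nullary.Decidable using (⌊_⌋)
open import Data.Bool.Properties using (T?)

-- A bipartite graph with parts U = Fin n and V = Fin n (disjoint copies),
-- given by its biadjacency relation: adj u v = true iff u ∈ U is joined to v ∈ V.
record BipGraph (n : ℕ) : Set where
  field
    adj : Fin n → Fin n → Bool

open BipGraph public

Edge : ∀ {n} → BipGraph n → Fin n → Fin n → Set
Edge G u v = T (adj G u v)

edgeCount : ∀ {n} → BipGraph n → ℕ
edgeCount {n} G =
  length (filter (λ p → T? (adj G (proj₁ p) (proj₂ p)))
                 (cartesianProduct (allFin n) (allFin n)))

-- cyclic successor on Fin m (m ≥ 1): i ↦ i+1 mod m
cyc : ∀ {m} → Fin (suc m) → Fin (suc m)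
cyc {m} i = go m i
  where
  go : (k : ℕ) → Fin (suc k) → Fin (suc k)
  go zero zero = zero
  go (suc k) zero = suc zero
  go (suc k) (suc j) with go k j
  ... | zero = zero      -- j was the last element of Fin (suc k): wrap
  ... | suc r = suc (suc r)

-- A cycle of length 2m in G (m = suc m'): pairwise distinct vertices
-- u_0,…,u_{m-1} ∈ U and v_0,…,v_{m-1} ∈ V, with edges u_i v_i and v_i u_{i+1 mod m}.
record Cycle {n : ℕ} (G : BipGraph n) (m' : ℕ) : Set where
  field
    us : Fin (suc m') → Fin n
    vs : Fin (suc m') → Fin n
    us-inj : Injective _≡_ _≡_ us
    vs-inj : Injective _≡_ _≡_ vs
    edge₁ : ∀ i → Edge G (us i) (vs i)
    edge₂ : ∀ i → Edge G (us (cyc i)) (vs i)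

-- A chord: an edge u_i v_j of G that is not an edge of the cycle, i.e.
-- j ≠ i and j+1 ≠ i (mod m).
HasChord : ∀ {n m'} {G : BipGraph n} → Cycle G m' → Set
HasChord {m' = m'} {G} C =
  Σ (Fin (suc m')) λ i → Σ (Fin (suc m')) λ j →
    ¬ (j ≡ i) × ¬ (cyc j ≡ i) × Edge G (Cycle.us C i) (Cycle.vs C j)

-- Chordal bipartite: every cycle of length 2m ≥ 6 (i.e. m ≥ 3) has a chord.
ChordalBipartite : ∀ {n} → BipGraph n → Set
ChordalBipartite {n} G = ∀ (m' : ℕ) → 2 ≤ m' → (C : Cycle G m') → HasChord C

ContainsKkk : ∀ {n} → ℕ → BipGraph n → Set
ContainsKkk {n} k G =
  Σ (Fin k → Fin n) λ a → Σ (Fin k → Fin n) λ b →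
    Injective _≡_ _≡_ a × Injective _≡_ _≡_ b × (∀ i j → Edge G (a i) (b j))

{-# OPTIONS --safe #-}
-- Order rows and columns of the biadjacency matrix so that both are sorted
-- lexicographically, the last entries being the most significant.  Suppose that
-- rows r < s and columns c < d have ones at rc, rd, sc but not at sd.  As row s is
-- not smaller than row r, it has a one beyond d where r has a zero; taking the last
-- place where the two rows differ, and doing the same for the columns, prolongs the
-- path s c r d at both ends.  No chord arises, by the choice of the last place, and
-- the new ends are not joined, since that would close a chordless cycle.  The step
-- can be repeated with ends ever further out, which is absurd; so sd is a one.
-- Hence an edge with k-1 ones to its right and k-1 ones below it yields a K_{k,k},
-- and every edge is among the last k-1 of its row or the last k-1 of its column.
module Submission where

open import Defs
open import Algebra.Properties.CommutativeSemigroup using ()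
open import Algebra.Properties.Semiring.Sum using ()
open import Data.Bool using (T; true; false; if_then_else_)
open import Data.Bool.Properties using (T?)
open import Data.Empty using (⊥-elim)
open import Data.Fin using (Fin; zero; suc; toℕ; fromℕ; inject₁; inject≤; _≟_)
open import Data.Fin.Permutation using (Permutation′; _⟨$⟩ʳ_; _∘ₚ_; transpose)
  renaming (id to idₚ)
open import Data.Fin.Permutation.Components using () renaming (transpose to transposeᶠ)
open import Data.Fin.Properties using
  (toℕ-injective; toℕ-inject₁; toℕ-fromℕ; toℕ<n; any?; inject≤-injective; suc-injective)
open import Data.Fin.Relation.Unary.Top using (view; ‵fromℕ; ‵inject₁)
open import Data.List using (length; filter; tabulate; allFin; cartesianProduct; map; _++_)
open import Data.List.Extrema using ()
open import Data.List.Membership.Propositional.Properties using (∈-filter⁺; ∈-allFin)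
open import Data.List.Properties using (filter-++; length-++; map-tabulate)
open import Data.List.Relation.Unary.All as All using ()
open import Data.List.Relation.Unary.All.Properties using (all-filter)
open import Data.Nat using
  (ℕ; zero; suc; _+_; _*_; _∸_; _^_; _≤_; _<_; _<?_; z≤n; s≤s; s≤s⁻¹)
open import Data.Nat.Properties hiding (_≟_; suc-injective)
open import Data.Nat.Tactic.RingSolver using (solve-∀)
open import Data.Product using (_×_; _,_; ∃; ∃₂; proj₁; proj₂)
open import Data.Sum using (_⊎_; inj₁; inj₂)
open import Data.Vec.Functional using (_∷_)
open import Function using (_∘_; id; Injection)
open import Function.Definitions using (Injective)
open import Function.Properties.Inverse using (Inverse⇒Injection)
open import Relation.Binary.Definitions using (tri<; tri≈; tri>)
open import Relation.Binary.PropositionalEquality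
open import Relation.Nullary using (¬_; Dec; does; yes; no; contradiction)
open import Relation.Nullary.Decidable using (decidable-stable; _×-dec_; ¬?)

open Algebra.Properties.CommutativeSemigroup +-commutativeSemigroup using (x∙yz≈y∙xz)
open Algebra.Properties.Semiring.Sum +-*-semiring
  using (sum; sum-cong-≗; sum-permute; ∑-comm; ∑-distrib-+; *-distribˡ-sum)
open Data.List.Extrema ≤-totalOrder using (argmin; argmin-all; f[argmin]≤f[xs])

private
  variable
    n m : ℕ
    A : Set
    f g : Fin n → ℕ

-- The cyclic successor

-- The local function go of cyc is not nameable here, and recursion on cyc needs it
-- with its hidden parameters m and i decoupled from k and x.  Unification solves
-- the underscore by go at suc k and suc x in go⁺-solution, once m and i have been
-- abstracted to variables; f keeps suc k out of the type of the equation.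
mutual
  go⁺ : (m : ℕ) → Fin (suc m) → (k : ℕ) → Fin (suc k) → Fin (suc (suc k))
  go⁺ = _

  go⁺-solution : ∀ (f : ∀ k → Fin (suc (suc k)) → ℕ) k (x : Fin (suc k)) →
                 f k (cyc (suc x)) ≡ f k (go⁺ (suc k) (suc x) k x)
  go⁺-solution f k x with suc k | suc x
  ... | m | i = refl

go⁺-fromℕ : ∀ {m i} k → go⁺ m i k (fromℕ k) ≡ zero
go⁺-fromℕ zero = refl
go⁺-fromℕ {m} {i} (suc k) with go⁺ m i k (fromℕ k) | go⁺-fromℕ {m} {i} k
... | _ | refl = refl

go⁺-inject₁ : ∀ {m i k} (x : Fin k) → go⁺ m i k (inject₁ x) ≡ suc (suc x)
go⁺-inject₁ zero = refl
go⁺-inject₁ {m} {i} {suc k} (suc x)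
  with go⁺ m i k (inject₁ x) | go⁺-inject₁ {m} {i} x
... | _ | refl = refl

cyc-fromℕ : ∀ m → cyc (fromℕ m) ≡ zero
cyc-fromℕ zero    = refl
cyc-fromℕ (suc m) = go⁺-fromℕ {suc m} {suc (fromℕ m)} m

cyc-inject₁ : ∀ {m} (i : Fin m) → cyc (inject₁ i) ≡ suc i
cyc-inject₁ zero    = refl
cyc-inject₁ (suc i) = go⁺-inject₁ {_} {suc (inject₁ i)} i

cyc-injective : ∀ {m} → Injective _≡_ _≡_ (cyc {m})
cyc-injective {m} {i} {j} eq with view i | view j
... | ‵fromℕ     | ‵fromℕ     = refl
... | ‵fromℕ     | ‵inject₁ y =
  contradiction (trans (sym (cyc-fromℕ m)) (trans eq (cyc-inject₁ y))) λ ()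
... | ‵inject₁ x | ‵fromℕ     =
  contradiction (trans (sym (cyc-inject₁ x)) (trans eq (cyc-fromℕ m))) λ ()
... | ‵inject₁ x | ‵inject₁ y
  with refl ← trans (sym (cyc-inject₁ x)) (trans eq (cyc-inject₁ y)) = refl

-- Exchanging the two sides of the graph

infix 30 _ᵀ

_ᵀ : ∀ {n} → BipGraph n → BipGraph n
(G ᵀ) .adj u v = adj G v u

-- The same cycle is read from `vs zero` on, which shifts the `us` by `cyc`. A chord at `i`, `j`
-- becomes one at `cyc j`, `i`, and the two conditions of a chord exchange roles.
ᵀ-chordal : ∀ {n} {G : BipGraph n} → ChordalBipartite G → ChordalBipartite (G ᵀ)
ᵀ-chordal {G = G} chordal m 2≤m C
  = let i , j , j≢i , cj≢i , e = chordal m 2≤m C′ in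
    cyc j , i , (λ i≡cj → cj≢i (sym i≡cj)) , (λ ci≡cj → j≢i (sym (cyc-injective ci≡cj))) , e
  where
  open Cycle C
  C′ : Cycle G m
  C′ = record
    { us     = vs
    ; vs     = us ∘ cyc
    ; us-inj = vs-inj
    ; vs-inj = cyc-injective ∘ us-inj
    ; edge₁  = edge₂
    ; edge₂  = edge₁ ∘ cyc
    }

-- Chordless paths

infixl 5 _∷ʳ_

_∷ʳ_ : (Fin m → A) → A → Fin (suc m) → A
_∷ʳ_ {zero}  f x _       = x
_∷ʳ_ {suc m} f x zero    = f zero
_∷ʳ_ {suc m} f x (suc i) = (f ∘ suc ∷ʳ x) i

∷ʳ-inject₁ : (f : Fin m → A) (x : A) (i : Fin m) → (f ∷ʳ x) (inject₁ i) ≡ f i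
∷ʳ-inject₁ f x zero    = refl
∷ʳ-inject₁ f x (suc i) = ∷ʳ-inject₁ (f ∘ suc) x i

∷ʳ-fromℕ : (f : Fin m → A) (x : A) → (f ∷ʳ x) (fromℕ m) ≡ x
∷ʳ-fromℕ {zero}  f x = refl
∷ʳ-fromℕ {suc m} f x = ∷ʳ-fromℕ (f ∘ suc) x

-- A fence is a path us 0, vs 0, us 1, vs 1, …, us m, vs m whose only possible chord
-- is the edge joining its two ends.
Fence-adj : ∀ m → Fin (suc m) → Fin (suc m) → Set
Fence-adj m i j = toℕ i ≡ toℕ j ⊎ toℕ i ≡ suc (toℕ j) ⊎ (toℕ i ≡ 0 × toℕ j ≡ m)

record Fence (G : BipGraph n) (m : ℕ) : Set where
  field
    us vs   : Fin (suc m) → Fin n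
    diag    : ∀ i → Edge G (us i) (vs i)
    subdiag : ∀ i → Edge G (us (suc i)) (vs (inject₁ i))
    chordless : ∀ i j → Edge G (us i) (vs j) → Fence-adj m i j

-- This makes the vertices of a fence distinct: if `us i` and `us j` coincide, the diagonal edges
-- make `i`, `j` adjacent in both orders. For `m` equal to 1 it fails, as 0 and 1 are then both
-- consecutive and the two ends.
Fence-adj-antisym : ∀ {i j} → 2 ≤ m → Fence-adj m i j → Fence-adj m j i → i ≡ j
Fence-adj-antisym {m} {i} {j} 2≤m p q = toℕ-injective (go (toℕ i) (toℕ j) p q)
  where
  Adj : ℕ → ℕ → Set
  Adj i j = i ≡ j ⊎ i ≡ suc j ⊎ (i ≡ 0 × j ≡ m)
  go : ∀ i j → Adj i j → Adj j i → i ≡ j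
  go i j (inj₁ p) _ = p
  go i j (inj₂ _) (inj₁ q) = sym q
  go i j (inj₂ (inj₁ p)) (inj₂ (inj₁ q)) =
    contradiction (trans p (cong suc q)) (<⇒≢ (s≤s (n≤1+n i)))
  go i j (inj₂ (inj₁ refl)) (inj₂ (inj₂ (refl , refl))) = contradiction 2≤m λ { (s≤s ()) }
  go i j (inj₂ (inj₂ (refl , refl))) (inj₂ (inj₁ refl)) = contradiction 2≤m λ { (s≤s ()) }
  go i j (inj₂ (inj₂ (refl , refl))) (inj₂ (inj₂ (refl , refl))) = refl

-- The edge would close a cycle of length `2 * (m + 1)`, at least six, while every pair permitted by
-- `Fence-adj` is an edge of that cycle.
Fence-open : {G : BipGraph n} → ChordalBipartite G → 2 ≤ m → (F : Fence G m) →
             let open Fence F in ¬ Edge G (us zero) (vs (fromℕ m))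
Fence-open {m = m} {G} chordal 2≤m F closed
  = let i , j , j≢i , cj≢i , e = chordal m 2≤m C in
    noChord j≢i cj≢i (chordless i j e)
  where
  open Fence F
  closing : ∀ i → Edge G (us (cyc i)) (vs i)
  closing i with view i
  ... | ‵fromℕ     rewrite cyc-fromℕ m   = closed
  ... | ‵inject₁ j rewrite cyc-inject₁ j = subdiag j
  C : Cycle G m
  C = record
    { us = us
    ; vs = vs
    ; us-inj = λ {i} {j} eq → Fence-adj-antisym 2≤m
        (chordless i j (subst (λ u → Edge G u (vs j)) (sym eq) (diag j)))
        (chordless j i (subst (λ u → Edge G u (vs i)) eq (diag i)))
    ; vs-inj = λ {i} {j} eq → Fence-adj-antisym 2≤m
        (chordless i j (subst (Edge G (us i)) eq (diag i)))
        (chordless j i (subst (Edge G (us j)) (sym eq) (diag j)))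
    ; edge₁ = diag
    ; edge₂ = closing
    }
  noChord : ∀ {i j} → ¬ j ≡ i → ¬ cyc j ≡ i → ¬ Fence-adj m i j
  noChord j≢i _ (inj₁ i≡j) = j≢i (toℕ-injective (sym i≡j))
  noChord {i} {j} _ cj≢i (inj₂ p) with view j | p
  ... | ‵fromℕ | inj₁ i≡1+m = <⇒≢ (toℕ<n i) (trans i≡1+m (cong suc (toℕ-fromℕ m)))
  ... | ‵fromℕ | inj₂ (i≡0 , _) = cj≢i (trans (cyc-fromℕ m) (toℕ-injective (sym i≡0)))
  ... | ‵inject₁ k | inj₁ i≡1+k =
    cj≢i (trans (cyc-inject₁ k) (toℕ-injective (sym (trans i≡1+k (cong suc (toℕ-inject₁ k))))))
  ... | ‵inject₁ k | inj₂ (_ , k≡m) = <⇒≢ (toℕ<n k) (trans (sym (toℕ-inject₁ k)) k≡m)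

-- Doubly lexical orderings and the prolongation of paths

rank : Permutation′ n → Fin n → ℕ
rank α u = toℕ (α ⟨$⟩ʳ u)

rank<n : (α : Permutation′ n) (u : Fin n) → rank α u < n
rank<n α u = toℕ<n (α ⟨$⟩ʳ u)

-- Here r precedes s in the order given by α, and v is the last place where the two
-- rows differ.
LexSorted : BipGraph n → Permutation′ n → Permutation′ n → Set
LexSorted G α β =
  ∀ {r s w} → rank α r < rank α s → Edge G r w → ¬ Edge G s w →
  ∃ λ v → rank β w < rank β v × Edge G s v × ¬ Edge G r v ×
          (∀ x → rank β v < rank β x → Edge G r x → Edge G s x)

record DoublyLexSorted (G : BipGraph n) (α β : Permutation′ n) : Set where
  field
    rows : LexSorted G α β
    cols : LexSorted (G ᵀ) β α

ᵀ-sorted : {G : BipGraph n} {α β : Permutation′ n} →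
           DoublyLexSorted G α β → DoublyLexSorted (G ᵀ) β α
ᵀ-sorted sorted = record { rows = cols ; cols = rows }
  where open DoublyLexSorted sorted

-- The last two conditions say that, beyond the ends of the path, rows other than
-- us zero are contained in the row us m, and columns other than vs m in the column
-- vs zero.
record Path (G : BipGraph n) (α β : Permutation′ n) (m : ℕ) : Set where
  field
    fence : Fence G m
  open Fence fence public
  field
    ends-apart : ¬ Edge G (us zero) (vs (fromℕ m))
    u-ends     : rank α (us (fromℕ m)) < rank α (us zero)
    v-ends     : rank β (vs zero) < rank β (vs (fromℕ m))
    rows-agree : ∀ i x → rank β (vs (fromℕ m)) < rank β x →
                 Edge G (us (suc i)) x → Edge G (us (fromℕ m)) x
    cols-agree : ∀ i x → rank α (us zero) < rank α x →
                 Edge G x (vs (inject₁ i)) → Edge G x (vs zero)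

  height : ℕ
  height = rank α (us zero) + rank β (vs (fromℕ m))

-- The prolonged path starts and ends on the opposite sides, which is why it is
-- stated for the transposed graph.
Path-extend : {G : BipGraph n} {α β : Permutation′ n} →
              ChordalBipartite G → DoublyLexSorted G α β →
              (P : Path G α β (suc m)) →
              ∃ λ (Q : Path (G ᵀ) β α (suc (suc m))) → Path.height P < Path.height Q
Path-extend {n = n} {m} {G} {α} {β} chordal sorted P
  -- The last row of the path precedes row `us zero` and has a one in the last column, where row
  -- `us zero` has none. This gives a neighbour `v′` of `us zero` further out; dually `u′` is a
  -- neighbour of the last column.
  with v′ , v′-above , uv′ , ¬uv′ , v′-agree ← DoublyLexSorted.rows sorted
         (Path.u-ends P) (Path.diag P (fromℕ (suc m))) (Path.ends-apart P)
  with u′ , u′-above , u′v , ¬u′v , u′-agree ← DoublyLexSorted.cols sorted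
         (Path.v-ends P) (Path.diag P zero) (Path.ends-apart P)
  = Q , higher
  where
  open Path P
  -- The new path runs `v′`, `us zero`, `vs zero`, and so on to the last column and `u′`; old
  -- diagonal and subdiagonal edges exchange roles.
  us′ vs′ : Fin (suc (suc (suc m))) → Fin n
  us′ = v′ ∷ vs
  vs′ = us ∷ʳ u′

  vs′-inject₁ : ∀ i → vs′ (inject₁ i) ≡ us i
  vs′-inject₁ = ∷ʳ-inject₁ us u′

  vs′-last : vs′ (fromℕ (suc (suc m))) ≡ u′
  vs′-last = ∷ʳ-fromℕ us u′

  diag′ : ∀ i → Edge G (vs′ i) (us′ i)
  diag′ zero = uv′
  diag′ (suc i) with view i
  ... | ‵fromℕ     = subst (λ u → Edge G u (vs i)) (sym vs′-last) u′v
  ... | ‵inject₁ j = subst (λ u → Edge G u (vs i)) (sym (vs′-inject₁ (suc j))) (subdiag j)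

  chordless-below : ∀ i j → Edge G (us i) (vs j) → Fence-adj (suc (suc m)) (suc j) (inject₁ i)
  chordless-below i j e with chordless i j e
  ... | inj₁ i≡j        = inj₂ (inj₁ (cong suc (trans (sym i≡j) (sym (toℕ-inject₁ i)))))
  ... | inj₂ (inj₁ i≡1+j) = inj₁ (trans (sym i≡1+j) (sym (toℕ-inject₁ i)))
  -- The old ends are inner vertices of the new path and get no exemption.
  ... | inj₂ (inj₂ (i≡0 , j≡m))
    with refl ← toℕ-injective {i = i} {zero} i≡0
       | refl ← toℕ-injective {i = j} {fromℕ (suc m)} (trans j≡m (sym (toℕ-fromℕ _)))
    = contradiction e ends-apart

  chordless-v′ : ∀ i → Edge G (us i) v′ → Fence-adj (suc (suc m)) zero (inject₁ i)
  chordless-v′ zero    e = inj₁ refl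
  -- A chord from `v′` would pass to the last row by `rows-agree`, but `v′` was chosen outside that
  -- row.
  chordless-v′ (suc i) e = contradiction (rows-agree i v′ v′-above e) ¬uv′

  chordless-u′ : ∀ j → Edge G u′ (vs j) → Fence-adj (suc (suc m)) (suc j) (fromℕ (suc (suc m)))
  chordless-u′ j e with view j
  ... | ‵fromℕ     = inj₁ refl
  ... | ‵inject₁ k = contradiction (cols-agree k u′ u′-above e) ¬u′v

  chordless′ : ∀ i j → Edge G (vs′ j) (us′ i) → Fence-adj (suc (suc m)) i j
  chordless′ i j e with view j
  chordless′ zero    _ e | ‵fromℕ     = inj₂ (inj₂ (refl , toℕ-fromℕ _))
  chordless′ (suc i) _ e | ‵fromℕ     =
    chordless-u′ i (subst (λ u → Edge G u (vs i)) vs′-last e)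
  chordless′ zero    _ e | ‵inject₁ j =
    chordless-v′ j (subst (λ u → Edge G u v′) (vs′-inject₁ j) e)
  chordless′ (suc i) _ e | ‵inject₁ j =
    chordless-below j i (subst (λ u → Edge G u (vs i)) (vs′-inject₁ j) e)

  fence′ : Fence (G ᵀ) (suc (suc m))
  fence′ = record
    { us = us′
    ; vs = vs′
    ; diag = diag′
    ; subdiag = λ i → subst (λ u → Edge G u (vs i)) (sym (vs′-inject₁ i)) (diag i)
    ; chordless = chordless′
    }

  u′-top : rank α (us zero) < rank α (vs′ (fromℕ (suc (suc m))))
  u′-top = subst (λ u → rank α (us zero) < rank α u) (sym vs′-last) u′-above

  rows-agree′ : ∀ i x → rank α u′ < rank α x → Edge G x (vs i) → Edge G x (vs (fromℕ (suc m)))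
  rows-agree′ i x above e with view i
  ... | ‵fromℕ     = e
  -- Beyond `u′`, a one passes from any earlier column of the path to `vs zero`, and from there to
  -- the last column by the choice of `u′`.
  ... | ‵inject₁ j = u′-agree x above (cols-agree j x (<-trans u′-above above) e)

  cols-agree′ : ∀ i x → rank β v′ < rank β x → Edge G (us i) x → Edge G (us zero) x
  cols-agree′ zero    x above e = e
  cols-agree′ (suc i) x above e = v′-agree x above (rows-agree i x (<-trans v′-above above) e)

  Q : Path (G ᵀ) β α (suc (suc m))
  Q = record
    { fence = fence′
    -- The new fence has at least six vertices, so chordality applies; only for the initial corner
    -- must the missing edge be assumed.
    ; ends-apart = Fence-open (ᵀ-chordal chordal) (s≤s (s≤s z≤n)) fence′
    ; u-ends = v′-above
    ; v-ends = u′-top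
    ; rows-agree = λ i x above → rows-agree′ i x (subst (λ u → rank α u < rank α x) vs′-last above)
    ; cols-agree = λ i x above e →
        cols-agree′ i x above (subst (λ u → Edge G u x) (vs′-inject₁ i) e)
    }

  higher : height < Path.height Q
  higher = subst (height <_) (+-comm _ (rank β v′)) (+-mono-< u′-top v′-above)

-- The induction step of every bounded search below: one unit of fuel is spent when the measure
-- grows.
≤-+-descend : ∀ {l} k {a b} → l ≤ suc k + a → a < b → l ≤ k + b
≤-+-descend k {a} l≤1+k+a a<b =
  ≤-trans l≤1+k+a (≤-trans (≤-reflexive (sym (+-suc k a))) (+-monoʳ-≤ k a<b))

-- Ranks are below `n`, so a height stays below `n + n`, yet each prolongation raises it.
no-Path : ∀ k {G : BipGraph n} {α β : Permutation′ n} →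
          ChordalBipartite G → DoublyLexSorted G α β →
          (P : Path G α β (suc m)) → ¬ (n + n ≤ k + Path.height P)
no-Path zero {α = α} {β} _ _ P tall =
  <⇒≱ (+-mono-< (rank<n α _) (rank<n β _)) tall
no-Path (suc k) chordal sorted P tall with Q , higher ← Path-extend chordal sorted P =
  no-Path k (ᵀ-chordal chordal) (ᵀ-sorted sorted) Q
    (≤-+-descend k tall higher)

Γ-free : {G : BipGraph n} {α β : Permutation′ n} →
         ChordalBipartite G → DoublyLexSorted G α β →
         ∀ {r s c d} → rank α r < rank α s → rank β c < rank β d →
         Edge G r c → Edge G r d → Edge G s c → Edge G s d
Γ-free {n} {G} {α} {β} chordal sorted {r} {s} {c} {d} r<s c<d rc rd sc =
  decidable-stable (T? (adj G s d)) λ ¬sd →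
    no-Path (n + n) chordal sorted (corner ¬sd) (m≤m+n (n + n) _)
  where
  corner : ¬ Edge G s d → Path G α β 1
  corner ¬sd = record
    { fence = record
      { us = s ∷ r ∷ λ ()
      ; vs = c ∷ d ∷ λ ()
      ; diag = λ { zero → sc ; (suc zero) → rd }
      ; subdiag = λ { zero → rc }
      ; chordless = λ
        { zero       zero       _ → inj₁ refl
        ; zero       (suc zero) e → contradiction e ¬sd
        ; (suc zero) zero       _ → inj₂ (inj₁ refl)
        ; (suc zero) (suc zero) _ → inj₁ refl
        }
      }
    ; ends-apart = ¬sd
    ; u-ends = r<s
    ; v-ends = c<d
    -- Here the only row besides `us zero` is the last one, and the only column besides the last is
    -- `vs zero`.
    ; rows-agree = λ { zero x _ e → e }
    ; cols-agree = λ { zero x _ e → e }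
    }

-- Existence of a doubly lexical ordering

sum-mono-≤ : (∀ i → f i ≤ g i) → sum f ≤ sum g
sum-mono-≤ {zero}  f≤g = z≤n
sum-mono-≤ {suc n} f≤g = +-mono-≤ (f≤g zero) (sum-mono-≤ (f≤g ∘ suc))

-- Used with `c` equal to 1 for strict inequalities, and with `c` the weight of a column.
sum-mono-≤-gap : ∀ {c} → (∀ i → f i ≤ g i) → ∀ w → c + f w ≤ g w → c + sum f ≤ sum g
sum-mono-≤-gap {suc n} {f} {g} {c} f≤g zero gap =
  ≤-trans (≤-reflexive (sym (+-assoc c (f zero) _)))
          (+-mono-≤ gap (sum-mono-≤ (f≤g ∘ suc)))
sum-mono-≤-gap {suc n} {f} {g} {c} f≤g (suc w) gap =
  ≤-trans (≤-reflexive (x∙yz≈y∙xz c (f zero) _))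
          (+-mono-≤ (f≤g zero) (sum-mono-≤-gap (f≤g ∘ suc) w gap))

sum-≤ : ∀ {n b} {f : Fin n → ℕ} → (∀ i → f i ≤ b) → sum f ≤ n * b
sum-≤ {n = zero}  f≤b = z≤n
sum-≤ {n = suc n} f≤b = +-mono-≤ (f≤b zero) (sum-≤ (f≤b ∘ suc))

-- The two sides differ by the product of `y - x` and `p - q`, both positive.
rearrange-< : ∀ {x y p q} → x < y → q < p → x * p + y * q < y * p + x * q
rearrange-< {x} {y} {p} {q} x<y q<p
  with d , refl ← m≤n⇒∃[o]m+o≡n x<y | e , refl ← m≤n⇒∃[o]m+o≡n q<p =
  subst (x * p + y * q <_) (sym (identity x d q e)) (m<m+n _ (s≤s z≤n))
  where
  identity : ∀ x d q e →
    (suc x + d) * (suc q + e) + x * q ≡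
    x * (suc q + e) + (suc x + d) * q + suc d * suc e
  identity = solve-∀

transpose-matchˡ : (i j : Fin n) → transposeᶠ i j i ≡ j
transpose-matchˡ i j with i ≟ i
... | yes _  = refl
... | no i≢i = contradiction refl i≢i

transpose-matchʳ : (i j : Fin n) → transposeᶠ i j j ≡ i
transpose-matchʳ i j with j ≟ i
... | yes j≡i = j≡i
... | no _ with j ≟ j
...   | yes _  = refl
...   | no j≢j = contradiction refl j≢j

transpose-minimal : ∀ {i j k : Fin n} → k ≢ i → k ≢ j → transposeᶠ i j k ≡ k
transpose-minimal {i = i} {j} {k} k≢i k≢j with k ≟ i
... | yes k≡i = contradiction k≡i k≢i
... | no _ with k ≟ j
...   | yes k≡j = contradiction k≡j k≢j
...   | no _    = refl

transpose-involutive : (i j k : Fin n) → transposeᶠ i j (transposeᶠ i j k) ≡ k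
transpose-involutive i j k with k ≟ i
... | yes refl = transpose-matchʳ i j
... | no k≢i with k ≟ j
...   | yes refl = transpose-matchˡ i j
...   | no k≢j   = transpose-minimal k≢i k≢j

-- Doubling both sums pairs each index with its image under the transposition, so no terms need to
-- be extracted: the pairs at `r` and `s` grow by rearrangement, the others are unchanged.
sum-transpose-< : (a b : Fin n → ℕ) → ∀ {r s} → a r < a s → b s < b r →
                  sum (λ u → a u * b u) < sum (λ u → a (transposeᶠ r s u) * b u)
sum-transpose-< {n} a b {r} {s} ar<as bs<br =
  ≰⇒> λ new≤old → <⇒≱ doubled (+-mono-≤ new≤old new≤old)
  where
  τ = transposeᶠ r s
  old new : Fin n → ℕ
  old u = a u * b u
  new u = a (τ u) * b u

  newτ≡ : ∀ u → new (τ u) ≡ a u * b (τ u)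
  newτ≡ u = cong (λ w → a w * b (τ u)) (transpose-involutive r s u)

  at-r : old r + old (τ r) < new r + new (τ r)
  at-r rewrite newτ≡ r | transpose-matchˡ r s = rearrange-< ar<as bs<br

  at-s : old s + old (τ s) ≤ new s + new (τ s)
  at-s rewrite newτ≡ s | transpose-matchʳ r s =
    subst₂ _≤_ (+-comm (old r) (old s)) (+-comm (a s * b r) (a r * b s))
      (<⇒≤ (rearrange-< ar<as bs<br))

  pointwise′ : ∀ u → Dec (u ≡ r) → Dec (u ≡ s) → old u + old (τ u) ≤ new u + new (τ u)
  pointwise′ u (yes refl) _          = <⇒≤ at-r
  pointwise′ u (no _)     (yes refl) = at-s
  pointwise′ u (no u≢r)   (no u≢s) rewrite newτ≡ u | transpose-minimal u≢r u≢s = ≤-refl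

  pointwise : ∀ u → old u + old (τ u) ≤ new u + new (τ u)
  pointwise u = pointwise′ u (u ≟ r) (u ≟ s)

  double : ∀ h → sum h + sum h ≡ sum (λ u → h u + h (τ u))
  double h = trans (cong (sum h +_) (sum-permute h (transpose r s))) (sym (∑-distrib-+ h (h ∘ τ)))

  doubled : sum old + sum old < sum new + sum new
  doubled = subst₂ _<_ (sym (double old)) (sym (double new))
    (sum-mono-≤-gap pointwise r at-r)

-- The base exceeds the number of entries in a row, so comparing row weights amounts
-- to comparing rows lexicographically; swapping two rows that are out of order
-- increases the total weight, so a maximiser is sorted in both directions.
weight : Permutation′ n → Fin n → ℕ
weight {n} α u = suc n ^ rank α u

rowWeight : BipGraph n → Permutation′ n → Fin n → ℕ
rowWeight G β u = sum λ v → if adj G u v then weight β v else 0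

totalWeight : BipGraph n → Permutation′ n → Permutation′ n → ℕ
totalWeight G α β = sum λ u → weight α u * rowWeight G β u

-- Both sides sum `weight α u * weight β v` over the edges, so row swaps and column swaps raise the
-- same potential.
totalWeight-ᵀ : (G : BipGraph n) (α β : Permutation′ n) →
                totalWeight (G ᵀ) β α ≡ totalWeight G α β
totalWeight-ᵀ {n} G α β = begin
  (sum λ v → weight β v * sum λ u → entryᵀ u v)
    ≡⟨ sum-cong-≗ (λ v → *-distribˡ-sum (weight β v) (λ u → entryᵀ u v)) ⟩
  (sum λ v → sum λ u → weight β v * entryᵀ u v)
    ≡⟨ ∑-comm (λ v u → weight β v * entryᵀ u v) ⟩
  (sum λ u → sum λ v → weight β v * entryᵀ u v)
    ≡⟨ sum-cong-≗ (λ u → sum-cong-≗ λ v →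
         swap-factors (adj G u v) (weight β v) (weight α u)) ⟩
  (sum λ u → sum λ v → weight α u * entry u v)
    ≡⟨ sum-cong-≗ (λ u → *-distribˡ-sum (weight α u) (entry u)) ⟨
  (sum λ u → weight α u * sum (entry u))
    ∎
  where
  open ≡-Reasoning
  entry entryᵀ : Fin n → Fin n → ℕ
  entry  u v = if adj G u v then weight β v else 0
  entryᵀ u v = if adj G u v then weight α u else 0
  swap-factors : ∀ e x y → x * (if e then y else 0) ≡ y * (if e then x else 0)
  swap-factors true  x y = *-comm x y
  swap-factors false x y = trans (*-zeroʳ x) (sym (*-zeroʳ y))

weight-≤ : (α : Permutation′ n) (u : Fin n) → weight α u ≤ suc n ^ n
weight-≤ {n} α u = ^-monoʳ-≤ (suc n) (<⇒≤ (rank<n α u))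

if-≤ : ∀ e {x y} → (T e → x ≤ y) → (if e then x else 0) ≤ y
if-≤ true  x≤y = x≤y _
if-≤ false x≤y = z≤n

if-T : ∀ {e} → T e → ∀ x → (if e then x else 0) ≡ x
if-T {true} _ x = refl

if-¬T : ∀ {e} → ¬ T e → ∀ x → (if e then x else 0) ≡ 0
if-¬T {false} _  x = refl
if-¬T {true}  ¬t x = contradiction _ ¬t

maxWeight : ℕ → ℕ
maxWeight n = n * (suc n ^ n * (n * suc n ^ n))

totalWeight-≤ : (G : BipGraph n) (α β : Permutation′ n) → totalWeight G α β ≤ maxWeight n
totalWeight-≤ G α β = sum-≤ λ u → *-mono-≤ (weight-≤ α u)
  (sum-≤ λ v → if-≤ (adj G u v) λ _ → weight-≤ β v)

weight-mono-< : (α : Permutation′ n) {r s : Fin n} → rank α r < rank α s → weight α r < weight α s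
weight-mono-< {suc n} α = ^-monoʳ-< (suc (suc n)) (s≤s (s≤s z≤n))

RowsSorted : BipGraph n → Permutation′ n → Permutation′ n → Set
RowsSorted G α β = ∀ r s → rank α r < rank α s → rowWeight G β r ≤ rowWeight G β s

rowsSorted⊎heavier : (G : BipGraph n) (α β : Permutation′ n) →
  RowsSorted G α β ⊎ ∃ λ α′ → totalWeight G α β < totalWeight G α′ β
rowsSorted⊎heavier G α β
  with any? (λ r → any? (λ s → rank α r <? rank α s ×-dec rowWeight G β s <? rowWeight G β r))
... | yes (r , s , r<s , s<r) =
  inj₂ (transpose r s ∘ₚ α , sum-transpose-< (weight α) (rowWeight G β) (weight-mono-< α r<s) s<r)
... | no sorted = inj₁ λ r s r<s → ≮⇒≥ λ s<r → sorted (r , s , r<s , s<r)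

-- Swaps are made as long as the total weight grows, and `totalWeight-≤` bounds their number.
∃-sorted : (G : BipGraph n) → ∃₂ λ α β → RowsSorted G α β × RowsSorted (G ᵀ) β α
∃-sorted {n} G = search (suc (maxWeight n)) idₚ idₚ (m≤m+n _ _)
  where
  search : ∀ k α β → maxWeight n < k + totalWeight G α β →
           ∃₂ λ α β → RowsSorted G α β × RowsSorted (G ᵀ) β α
  search zero α β high = contradiction (totalWeight-≤ G α β) (<⇒≱ high)
  search (suc k) α β high with rowsSorted⊎heavier G α β | rowsSorted⊎heavier (G ᵀ) β α
  ... | inj₁ rows | inj₁ cols = α , β , rows , cols
  ... | inj₂ (α′ , heavier) | _ = search k α′ β (≤-+-descend k high heavier)
  ... | inj₁ _ | inj₂ (β′ , heavier) = search k α β′ (≤-+-descend k high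
    (subst₂ _<_ (totalWeight-ᵀ G α β) (totalWeight-ᵀ G α β′) heavier))

-- From sorted weights to lexicographic order

rank-injective : (α : Permutation′ n) {u v : Fin n} → rank α u ≡ rank α v → u ≡ v
rank-injective α eq = Injection.injective (Inverse⇒Injection α) (toℕ-injective eq)

-- All columns before `w` together weigh less than `w`, since the base `suc n` exceeds `n`. At rank
-- zero there are none, and `d` is 0.
weight-gap : (β : Permutation′ n) (w : Fin n) →
             ∃ λ d → (∀ v → rank β v < rank β w → weight β v ≤ d) × n * d < weight β w
weight-gap {n} β w with rank β w
... | zero  = 0 , (λ _ ()) , subst (_< 1) (sym (*-zeroʳ n)) (s≤s z≤n)
... | suc b = suc n ^ b , (λ v v<w → ^-monoʳ-≤ (suc n) (s≤s⁻¹ v<w)) ,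
              m<n+m (n * suc n ^ b) (m^n>0 (suc n) b)

sum-+-const : (f : Fin n → ℕ) (d : ℕ) → sum (λ i → f i + d) ≤ sum f + n * d
sum-+-const {n} f d =
  ≤-trans (≤-reflexive (∑-distrib-+ f λ _ → d)) (+-monoʳ-≤ (sum f) (sum-≤ {n} {f = λ _ → d} λ _ → ≤-refl))

-- Otherwise every one of row `s` beyond `w` is also in row `r`. Granting row `r` a surplus `d` per
-- column covers the columns before `w`, and the weight of `w` itself outweighs all these surpluses,
-- so row `s` would be lighter.
RowsSorted⇒exceeds : {G : BipGraph n} {α β : Permutation′ n} → RowsSorted G α β →
  ∀ {r s w} → rank α r < rank α s → Edge G r w → ¬ Edge G s w →
  ∃ λ v → rank β w < rank β v × Edge G s v × ¬ Edge G r v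
RowsSorted⇒exceeds {n} {G} {α} {β} sorted {r} {s} {w} r<s rw ¬sw
  with any? (λ v → rank β w <? rank β v ×-dec T? (adj G s v) ×-dec ¬? (T? (adj G r v)))
... | yes found = found
... | no none with d , below , nd<w ← weight-gap β w =
  contradiction (sorted r s r<s) (<⇒≱ (+-cancelʳ-< (n * d) _ _ (begin-strict
    rowWeight G β s + n * d      <⟨ +-monoʳ-< (rowWeight G β s) nd<w ⟩
    rowWeight G β s + weight β w ≡⟨ +-comm (rowWeight G β s) (weight β w) ⟩
    weight β w + rowWeight G β s ≤⟨ sum-mono-≤-gap (entry≤ below) w at-w ⟩
    sum (λ v → entry r v + d)    ≤⟨ sum-+-const (entry r) d ⟩
    rowWeight G β r + n * d      ∎)))
  where
  open ≤-Reasoning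
  entry : Fin n → Fin n → ℕ
  entry u v = if adj G u v then weight β v else 0

  at-w : ∀ {d} → weight β w + entry s w ≤ entry r w + d
  at-w rewrite if-¬T ¬sw (weight β w) | if-T rw (weight β w) = +-monoʳ-≤ (weight β w) z≤n

  entry≤ : ∀ {d} → (∀ v → rank β v < rank β w → weight β v ≤ d) → ∀ v → entry s v ≤ entry r v + d
  entry≤ below v = if-≤ (adj G s v) λ sv → weight≤ sv
    where
    weight≤ : Edge G s v → weight β v ≤ entry r v + _
    weight≤ sv with <-cmp (rank β v) (rank β w)
    ... | tri< v<w _ _ = m≤n⇒m≤o+n _ (below v v<w)
    ... | tri≈ _ v≡w _ with refl ← rank-injective β v≡w = contradiction sv ¬sw
    ... | tri> _ _ w<v
      rewrite if-T (decidable-stable (T? (adj G r v)) λ ¬rv → none (v , w<v , sv , ¬rv)) (weight β v)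
      = m≤m+n _ _

-- If row `r` again has a one missing from row `s` beyond the place found, the search restarts from
-- there, at a larger rank.
RowsSorted⇒LexSorted : {G : BipGraph n} {α β : Permutation′ n} → RowsSorted G α β → LexSorted G α β
RowsSorted⇒LexSorted {n} {G} {α} {β} sorted {r} {s} {w} r<s = search n (m≤m+n n _)
  where
  search : ∀ k {w} → n ≤ k + rank β w → Edge G r w → ¬ Edge G s w →
    ∃ λ v → rank β w < rank β v × Edge G s v × ¬ Edge G r v ×
            (∀ x → rank β v < rank β x → Edge G r x → Edge G s x)
  search zero    {w} n≤w = contradiction n≤w (<⇒≱ (rank<n β w))
  search (suc k) {w} n≤k+w rw ¬sw
    with v , w<v , sv , ¬rv ← RowsSorted⇒exceeds {α = α} {β} sorted r<s rw ¬sw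
    with any? (λ x → rank β v <? rank β x ×-dec T? (adj G r x) ×-dec ¬? (T? (adj G s x)))
  ... | no none = v , w<v , sv , ¬rv , λ x v<x rx →
    decidable-stable (T? (adj G s x)) λ ¬sx → none (x , v<x , rx , ¬sx)
  ... | yes (x , v<x , rx , ¬sx)
    with v′ , x<v′ , rest ← search k (≤-+-descend k n≤k+w (<-trans w<v v<x)) rx ¬sx
    = v′ , <-trans (<-trans w<v v<x) x<v′ , rest

∃-doublyLexSorted : (G : BipGraph n) → ∃₂ (DoublyLexSorted G)
∃-doublyLexSorted G with α , β , rows , cols ← ∃-sorted G =
  α , β , record
    { rows = RowsSorted⇒LexSorted {α = α} {β} rows
    ; cols = RowsSorted⇒LexSorted {α = β} {α} cols
    }

-- Counting

indicator : ∀ {P : Set} → Dec P → ℕ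
indicator P? = if does P? then 1 else 0

count : {P : Fin n → Set} → (∀ i → Dec (P i)) → ℕ
count P? = sum λ i → indicator (P? i)

length-filter-tabulate : {A : Set} {P : A → Set} (P? : ∀ x → Dec (P x)) (f : Fin n → A) →
                         length (filter P? (tabulate f)) ≡ count (P? ∘ f)
length-filter-tabulate {zero}  P? f = refl
length-filter-tabulate {suc n} P? f with does (P? (f zero))
... | true  = cong suc (length-filter-tabulate P? (f ∘ suc))
... | false = length-filter-tabulate P? (f ∘ suc)

length-filter-cartesianProduct :
  ∀ {m n} {A B : Set} {P : A × B → Set} (P? : ∀ x → Dec (P x)) (f : Fin m → A) (g : Fin n → B) →
  length (filter P? (cartesianProduct (tabulate f) (tabulate g))) ≡
  sum λ i → count λ j → P? (f i , g j)
length-filter-cartesianProduct {zero}  P? f g = refl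
length-filter-cartesianProduct {suc m} P? f g = begin
  length (filter P? (row ++ rest))
    ≡⟨ cong length (filter-++ P? row rest) ⟩
  length (filter P? row ++ filter P? rest)
    ≡⟨ length-++ (filter P? row) ⟩
  length (filter P? row) + length (filter P? rest)
    ≡⟨ cong₂ _+_ row≡ (length-filter-cartesianProduct P? (f ∘ suc) g) ⟩
  (sum λ i → count λ j → P? (f i , g j))
    ∎
  where
  open ≡-Reasoning
  row  = map (f zero ,_) (tabulate g)
  rest = cartesianProduct (tabulate (f ∘ suc)) (tabulate g)
  row≡ : length (filter P? row) ≡ count λ j → P? (f zero , g j)
  row≡ = trans (cong (length ∘ filter P?) (map-tabulate g (f zero ,_)))
               (length-filter-tabulate P? ((f zero ,_) ∘ g))

indicator-⊎ : ∀ {P Q R : Set} (P? : Dec P) (Q? : Dec Q) (R? : Dec R) → (P → Q ⊎ R) →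
              indicator P? ≤ indicator Q? + indicator R?
indicator-⊎ (no _)  _       _       _ = z≤n
indicator-⊎ (yes _) (yes _) _       _ = s≤s z≤n
indicator-⊎ (yes _) (no _)  (yes _) _ = s≤s z≤n
indicator-⊎ (yes p) (no ¬q) (no ¬r) split with split p
... | inj₁ q = contradiction q ¬q
... | inj₂ r = contradiction r ¬r

indicator-mono : ∀ {P Q : Set} (P? : Dec P) (Q? : Dec Q) → (P → Q) → indicator P? ≤ indicator Q?
indicator-mono (no _)  _       _   = z≤n
indicator-mono (yes _) (yes _) _   = s≤s z≤n
indicator-mono (yes p) (no ¬q) p⇒q = contradiction (p⇒q p) ¬q

indicator≤1 : ∀ {P : Set} (P? : Dec P) → indicator P? ≤ 1
indicator≤1 P? = if-≤ (does P?) λ _ → ≤-refl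

count-mono-except : {P Q : Fin n → Set} (P? : ∀ i → Dec (P i)) (Q? : ∀ i → Dec (Q i)) (w : Fin n) →
                    (∀ i → i ≢ w → P i → Q i) → count P? ≤ suc (count Q?)
count-mono-except P? Q? zero P⇒Q =
  +-mono-≤ (indicator≤1 (P? zero))
    (≤-trans (sum-mono-≤ λ i → indicator-mono (P? (suc i)) (Q? (suc i)) (P⇒Q (suc i) λ ()))
             (m≤n+m _ (indicator (Q? zero))))
count-mono-except P? Q? (suc w) P⇒Q =
  ≤-trans (+-mono-≤ (indicator-mono (P? zero) (Q? zero) (P⇒Q zero λ ()))
                    (count-mono-except (P? ∘ suc) (Q? ∘ suc) w
                      λ i i≢w → P⇒Q (suc i) (i≢w ∘ suc-injective)))
          (≤-reflexive (+-suc (indicator (Q? zero)) _))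

count-none : {P : Fin n → Set} (P? : ∀ i → Dec (P i)) → (∀ i → ¬ P i) → count P? ≤ 0
count-none {n} P? none =
  subst (count P? ≤_) (*-zeroʳ n) (sum-≤ λ i → indicator-none (P? i) (none i))
  where
  indicator-none : ∀ {P : Set} (P? : Dec P) → ¬ P → indicator P? ≤ 0
  indicator-none (yes p) ¬p = contradiction p ¬p
  indicator-none (no _)  _  = z≤n

∷-injective : ∀ {k} {x : Fin n} {f : Fin k → Fin n} →
              (∀ i → x ≢ f i) → Injective _≡_ _≡_ f → Injective _≡_ _≡_ (x ∷ f)
∷-injective x∉f inj {zero}  {zero}  eq = refl
∷-injective x∉f inj {zero}  {suc j} eq = contradiction eq (x∉f j)
∷-injective x∉f inj {suc i} {zero}  eq = contradiction (sym eq) (x∉f i)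
∷-injective x∉f inj {suc i} {suc j} eq = cong suc (inj eq)

enumerate : {P : Fin n → Set} (P? : ∀ i → Dec (P i)) →
            ∃ λ (f : Fin (count P?) → Fin n) → Injective _≡_ _≡_ f × (∀ i → P (f i))
enumerate {zero}  P? = (λ ()) , (λ { {()} }) , λ ()
enumerate {suc n} P? with P? zero | enumerate (P? ∘ suc)
... | no _  | f , inj , all = suc ∘ f , inj ∘ suc-injective , all
... | yes p | f , inj , all =
  zero ∷ (suc ∘ f) ,
  ∷-injective (λ _ ()) (inj ∘ suc-injective) ,
  λ { zero → p ; (suc i) → all i }

choose : ∀ {k} {P : Fin n → Set} (P? : ∀ i → Dec (P i)) → k ≤ count P? →
         ∃ λ (f : Fin k → Fin n) → Injective _≡_ _≡_ f × (∀ i → P (f i))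
choose P? k≤ with f , inj , all ← enumerate P? =
  (λ i → f (inject≤ i k≤)) ,
  (λ {i} {j} eq → inject≤-injective k≤ k≤ i j (inj eq)) ,
  λ i → all (inject≤ i k≤)

-- Late entries and the edge bound

beyond? : (G : BipGraph n) (β : Permutation′ n) (u v : Fin n) →
          ∀ x → Dec (rank β v < rank β x × Edge G u x)
beyond? G β u v x = rank β v <? rank β x ×-dec T? (adj G u x)

LateEntry : BipGraph n → Permutation′ n → ℕ → Fin n → Fin n → Set
LateEntry G β k u v = Edge G u v × count (beyond? G β u v) < k

lateEntry? : (G : BipGraph n) (β : Permutation′ n) (k : ℕ) (u v : Fin n) → Dec (LateEntry G β k u v)
lateEntry? G β k u v = T? (adj G u v) ×-dec count (beyond? G β u v) <? k

-- All late entries other than the first lie beyond it, and being late it has fewer than `k` entries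
-- beyond.
lateEntries-≤ : (G : BipGraph n) (β : Permutation′ n) (k : ℕ) (u : Fin n) →
                count (lateEntry? G β k u) ≤ k
lateEntries-≤ {n} G β k u with any? (lateEntry? G β k u)
... | no none = ≤-trans (count-none (lateEntry? G β k u) λ i late → none (i , late)) z≤n
... | yes (v₀ , late₀) = ≤-trans
  (count-mono-except late? (beyond? G β u v) v λ x x≢v late →
    ≤∧≢⇒< (first x late) (λ eq → x≢v (rank-injective β (sym eq))) , proj₁ late)
  (proj₂ v-late)
  where
  late? = lateEntry? G β k u
  lateEntries = filter late? (allFin n)
  -- The default `v₀` is itself late, so the minimiser is late in any case.
  v = argmin (rank β) v₀ lateEntries
  v-late : LateEntry G β k u v
  v-late = argmin-all (rank β) late₀ (all-filter late? (allFin n))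
  first : ∀ x → LateEntry G β k u x → rank β v ≤ rank β x
  first x late = All.lookup (f[argmin]≤f[xs] v₀ lateEntries) (∈-filter⁺ late? (∈-allFin x) late)

late-row⊎column : {G : BipGraph n} {α β : Permutation′ n} {k : ℕ} →
  ChordalBipartite G → DoublyLexSorted G α β → ¬ ContainsKkk (suc k) G →
  ∀ u v → Edge G u v → LateEntry G β k u v ⊎ LateEntry (G ᵀ) α k v u
late-row⊎column {G = G} {α} {β} {k} chordal sorted noKkk u v uv
  with count (beyond? G β u v) <? k | count (beyond? (G ᵀ) α v u) <? k
... | yes few | _       = inj₁ (uv , few)
... | no _    | yes few = inj₂ (uv , few)
... | no many-right | no many-below
  with c , c-inj , right ← choose (beyond? G β u v) (≮⇒≥ many-right)
     | r , r-inj , below ← choose (beyond? (G ᵀ) α v u) (≮⇒≥ many-below)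
  -- The first row and column of the biclique are given; every other entry is the fourth corner of a
  -- rectangle at `u`, `v`.
  = ⊥-elim (noKkk
      ( u ∷ r , v ∷ c
      , ∷-injective (λ i eq → <⇒≢ (proj₁ (below i)) (cong (rank α) eq)) r-inj
      , ∷-injective (λ i eq → <⇒≢ (proj₁ (right i)) (cong (rank β) eq)) c-inj
      , λ { zero    zero    → uv
          ; zero    (suc j) → proj₂ (right j)
          ; (suc i) zero    → proj₂ (below i)
          ; (suc i) (suc j) → Γ-free chordal sorted (proj₁ (below i)) (proj₁ (right j))
                                uv (proj₂ (right j)) (proj₂ (below i))
          }))

-- Each edge is charged to its row or its column, and each of these `n + n` lines receives at most
-- `k` charges.
edgeCount-≤ : {G : BipGraph n} {α β : Permutation′ n} {k : ℕ} →
  ChordalBipartite G → DoublyLexSorted G α β → ¬ ContainsKkk (suc k) G →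
  edgeCount G ≤ 2 * n * k
edgeCount-≤ {n} {G} {α} {β} {k} chordal sorted noKkk = begin
  edgeCount G
    ≡⟨ length-filter-cartesianProduct (λ p → T? (adj G (proj₁ p) (proj₂ p))) id id ⟩
  (sum λ u → count λ v → T? (adj G u v))
    ≤⟨ sum-mono-≤ (λ u → sum-mono-≤ λ v → indicator-⊎ (T? (adj G u v)) (row? u v) (col? v u)
         (late-row⊎column chordal sorted noKkk u v)) ⟩
  (sum λ u → sum λ v → indicator (row? u v) + indicator (col? v u))
    ≡⟨ sum-cong-≗ (λ u → ∑-distrib-+ (λ v → indicator (row? u v)) (λ v → indicator (col? v u))) ⟩
  (sum λ u → count (row? u) + sum λ v → indicator (col? v u))
    ≡⟨ ∑-distrib-+ (λ u → count (row? u)) (λ u → sum λ v → indicator (col? v u)) ⟩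
  (sum λ u → count (row? u)) + (sum λ u → sum λ v → indicator (col? v u))
    ≡⟨ cong ((sum λ u → count (row? u)) +_) (∑-comm λ u v → indicator (col? v u)) ⟩
  (sum λ u → count (row? u)) + (sum λ v → count (col? v))
    ≤⟨ +-mono-≤ (sum-≤ (lateEntries-≤ G β k)) (sum-≤ (lateEntries-≤ (G ᵀ) α k)) ⟩
  n * k + n * k
    ≡⟨ *-distribʳ-+ k n n ⟨
  (n + n) * k
    ≡⟨ cong (λ m → (n + m) * k) (+-identityʳ n) ⟨
  2 * n * k
    ∎
  where
  open ≤-Reasoning
  row? : ∀ u v → Dec (LateEntry G β k u v)
  row? = lateEntry? G β k
  col? : ∀ v u → Dec (LateEntry (G ᵀ) α k v u)
  col? = lateEntry? (G ᵀ) α k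

theorem4 : (k n : ℕ) → 1 ≤ k → 1 ≤ n → (G : BipGraph n) → ChordalBipartite G →
    ¬ ContainsKkk k G → edgeCount G ≤ 2 * n * (k ∸ 1)
theorem4 (suc k) n _ _ G chordal noKkk with α , β , sorted ← ∃-doublyLexSorted G =
  edgeCount-≤ chordal sorted noKkk
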